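{- Let $n\ge 0$ and $m\ge \ell\ge 0$ be integers and set $N_0=\min\{n+1,\,m-\ell\}$. Then, as polynomials in $x,y$, $$\sum_{k=0}^{N_0}\det\begin{pmatrix} M_{n,k}(x,y) & M_{m,k+\ell+1}(x,y)\\ M_{n+1,k}(x,y) & M_{m+1,k+\ell+1}(x,y)\end{pmatrix}=M_{n,0}(x,y)\,M_{m,\ell}(y,y).$$
   Context: A partial Motzkin path from $(0,0)$ to $(n,k)$ is a lattice path that never goes below the $X$-axis and consists of up steps $U=(1,1)$, down steps $D=(1,-1)$ and horizontal steps $H=(1,0)$. In a weighted partial Motzkin path, every up step and every down step has weight $1$, every horizontal step lying on the $X$-axis has weight $x$, and every horizontal step not lying on the $X$-axis has weight $y$; the weight of a path is the product of the weights of its steps. $M_{n,k}(x,y)$ is the sum of the weights of all partial Motzkin paths from $(0,0)$ to $(n,k)$. Equivalently, $M_{0,0}(x,y)=1$, $M_{n,k}(x,y)=0$ if $n<k$ or $k<0$, $M_{n,0}(x,y)=xM_{n-1,0}(x,y)+M_{n-1,1}(x,y)$ for $n\ge1$, and $M_{n,k}(x,y)=M_{n-1,k-1}(x,y)+yM_{n-1,k}(x,y)+M_{n-1,k+1}(x,y)$ for $n\ge k\ge 1$. $M_{n,k}(y,y)$ denotes the polynomial obtained by substituting $x=y$. -}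

module Defs where

open import Algebra.Bundles using (AbelianGroup; CommutativeRing)
open import Algebra.Structures using (IsAbelianGroup)
import Algebra.Properties.Ring as RingProperties
import Algebra.Properties.CommutativeSemigroup as CommutativeSemigroupProperties
import Algebra.Properties.Monoid.Sum as MonoidSum
import Data.Integer.Properties as ℤₚ
open import Data.List.Base using (List; []; _∷_; map; _++_; foldr)
open import Data.List.Membership.Propositional using (_∈_)
open import Data.List.Membership.Propositional.Properties 
  using (∈-map⁺; ∈-map⁻; ∈-++⁺ˡ; ∈-++⁺ʳ; ∈-++⁻)
open import Data.List.Relation.Binary.Disjoint.Propositional using (Disjoint)
open import Data.List.Relation.Unary.All using ([])
open import Data.List.Relation.Unary.AllPairs using ([]; _∷_)
open import Data.List.Relation.Unary.Any using (here)
open import Data.List.Relation.Unary.Unique.Propositional using (Unique)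
import Data.List.Relation.Unary.Unique.Propositional.Properties as Unique
open import Data.Nat.Base using (ℕ; zero; suc)
open import Data.Product.Base using (_,_)
open import Data.Sum.Base using (inj₁; inj₂)
open import Level using (0ℓ)
open import Relation.Binary.PropositionalEquality using (_≡_; refl)
import Relation.Binary.Reasoning.Setoid as SetoidReasoning

-- Univariate polynomials over R as coefficient lists, constant term first.
-- Trailing zeros are allowed, so equality is equality of all coefficients.
module Polynomial {c ℓ} (R : CommutativeRing c ℓ) where
  private module R = CommutativeRing R
  open R using (Carrier; _≈_; 0#; 1#)

  Poly : Set c
  Poly = List Carrier

  coeff : Poly → ℕ → Carrier
  coeff []      _       = 0#
  coeff (a ∷ p) zero    = a
  coeff (a ∷ p) (suc i) = coeff p i

  infix 4 _≋_
  record _≋_ (p q : Poly) : Set ℓ where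
    constructor mk
    field at : ∀ i → coeff p i ≈ coeff q i
  open _≋_ public

  infixl 6 _⊕_
  infixl 7 _⊛_
  infixr 7 _·_

  _⊕_ : Poly → Poly → Poly
  []      ⊕ q       = q
  (a ∷ p) ⊕ []      = a ∷ p
  (a ∷ p) ⊕ (b ∷ q) = (a R.+ b) ∷ (p ⊕ q)

  _·_ : Carrier → Poly → Poly
  a · p = map (a R.*_) p

  _⊛_ : Poly → Poly → Poly
  []      ⊛ q = []
  (a ∷ p) ⊛ q = (a · q) ⊕ (0# ∷ (p ⊛ q))

  ⊖_ : Poly → Poly
  ⊖ p = map R.-_ p

  const : Carrier → Poly
  const a = a ∷ []

  indeterminate : Poly
  indeterminate = 0# ∷ 1# ∷ []

  eval : Poly → Carrier → Carrier
  eval []      r = 0#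
  eval (a ∷ p) r = a R.+ r R.* eval p r

  ≋-refl : ∀ {p} → p ≋ p
  ≋-refl .at i = R.refl

  ≋-sym : ∀ {p q} → p ≋ q → q ≋ p
  ≋-sym e .at i = R.sym (e .at i)

  ≋-trans : ∀ {p q r} → p ≋ q → q ≋ r → p ≋ r
  ≋-trans e f .at i = R.trans (e .at i) (f .at i)

  private
    open RingProperties R.ring using (-0#≈0#)

    coeff-⊕ : ∀ p q i → coeff (p ⊕ q) i ≈ coeff p i R.+ coeff q i
    coeff-⊕ []      q       i       = R.sym (R.+-identityˡ _)
    coeff-⊕ (a ∷ p) []      i       = R.sym (R.+-identityʳ _)
    coeff-⊕ (a ∷ p) (b ∷ q) zero    = R.refl
    coeff-⊕ (a ∷ p) (b ∷ q) (suc i) = coeff-⊕ p q i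

    coeff-· : ∀ a p i → coeff (a · p) i ≈ a R.* coeff p i
    coeff-· a []      i       = R.sym (R.zeroʳ a)
    coeff-· a (b ∷ p) zero    = R.refl
    coeff-· a (b ∷ p) (suc i) = coeff-· a p i

    coeff-⊖ : ∀ p i → coeff (⊖ p) i ≈ R.- coeff p i
    coeff-⊖ []      i       = R.sym -0#≈0#
    coeff-⊖ (b ∷ p) zero    = R.refl
    coeff-⊖ (b ∷ p) (suc i) = coeff-⊖ p i

    ∷-cong : ∀ {a b p q} → a ≈ b → p ≋ q → (a ∷ p) ≋ (b ∷ q)
    ∷-cong e f .at zero    = e
    ∷-cong e f .at (suc i) = f .at i

    ⊕-cong : ∀ {p p′ q q′} → p ≋ p′ → q ≋ q′ → (p ⊕ q) ≋ (p′ ⊕ q′)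
    ⊕-cong {p} {p′} {q} {q′} e f .at i = begin
      coeff (p ⊕ q) i           ≈⟨ coeff-⊕ p q i ⟩
      coeff p i R.+ coeff q i   ≈⟨ R.+-cong (e .at i) (f .at i) ⟩
      coeff p′ i R.+ coeff q′ i ≈⟨ coeff-⊕ p′ q′ i ⟨
      coeff (p′ ⊕ q′) i         ∎
      where open SetoidReasoning R.setoid

    ⊕-assoc : ∀ p q r → ((p ⊕ q) ⊕ r) ≋ (p ⊕ (q ⊕ r))
    ⊕-assoc p q r .at i = begin
      coeff ((p ⊕ q) ⊕ r) i                   ≈⟨ coeff-⊕ (p ⊕ q) r i ⟩
      coeff (p ⊕ q) i R.+ coeff r i           ≈⟨ R.+-congʳ (coeff-⊕ p q i) ⟩
      coeff p i R.+ coeff q i R.+ coeff r i   ≈⟨ R.+-assoc _ _ _ ⟩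
      coeff p i R.+ (coeff q i R.+ coeff r i) ≈⟨ R.+-congˡ (coeff-⊕ q r i) ⟨
      coeff p i R.+ coeff (q ⊕ r) i           ≈⟨ coeff-⊕ p (q ⊕ r) i ⟨
      coeff (p ⊕ (q ⊕ r)) i                   ∎
      where open SetoidReasoning R.setoid

    ⊕-comm : ∀ p q → (p ⊕ q) ≋ (q ⊕ p)
    ⊕-comm p q .at i =
      R.trans (coeff-⊕ p q i) (R.trans (R.+-comm _ _) (R.sym (coeff-⊕ q p i)))

    ⊕-identityʳ : ∀ p → (p ⊕ []) ≋ p
    ⊕-identityʳ p = ⊕-comm p []

    ⊖-cong : ∀ {p q} → p ≋ q → (⊖ p) ≋ (⊖ q)
    ⊖-cong {p} {q} e .at i =
      R.trans (coeff-⊖ p i) (R.trans (R.-‿cong (e .at i)) (R.sym (coeff-⊖ q i)))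

    ⊖-inverseˡ : ∀ p → ((⊖ p) ⊕ p) ≋ []
    ⊖-inverseˡ p .at i = begin
      coeff ((⊖ p) ⊕ p) i           ≈⟨ coeff-⊕ (⊖ p) p i ⟩
      coeff (⊖ p) i R.+ coeff p i   ≈⟨ R.+-congʳ (coeff-⊖ p i) ⟩
      (R.- coeff p i) R.+ coeff p i ≈⟨ R.-‿inverseˡ _ ⟩
      0#                            ∎
      where open SetoidReasoning R.setoid

    ·-cong : ∀ {a b p q} → a ≈ b → p ≋ q → (a · p) ≋ (b · q)
    ·-cong {a} {b} {p} {q} e f .at i =
      R.trans (coeff-· a p i) (R.trans (R.*-cong e (f .at i)) (R.sym (coeff-· b q i)))

    ·-distrib-⊕ : ∀ a p q → (a · (p ⊕ q)) ≋ ((a · p) ⊕ (a · q))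
    ·-distrib-⊕ a p q .at i = begin
      coeff (a · (p ⊕ q)) i                 ≈⟨ coeff-· a (p ⊕ q) i ⟩
      a R.* coeff (p ⊕ q) i                 ≈⟨ R.*-congˡ (coeff-⊕ p q i) ⟩
      a R.* (coeff p i R.+ coeff q i)       ≈⟨ R.distribˡ _ _ _ ⟩
      a R.* coeff p i R.+ a R.* coeff q i   ≈⟨ R.+-cong (coeff-· a p i) (coeff-· a q i) ⟨
      coeff (a · p) i R.+ coeff (a · q) i   ≈⟨ coeff-⊕ (a · p) (a · q) i ⟨
      coeff ((a · p) ⊕ (a · q)) i           ∎
      where open SetoidReasoning R.setoid

    ·-·-assoc : ∀ a b p → ((a R.* b) · p) ≋ (a · (b · p))
    ·-·-assoc a b p .at i = begin
      coeff ((a R.* b) · p) i   ≈⟨ coeff-· (a R.* b) p i ⟩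
      a R.* b R.* coeff p i     ≈⟨ R.*-assoc _ _ _ ⟩
      a R.* (b R.* coeff p i)   ≈⟨ R.*-congˡ (coeff-· b p i) ⟨
      a R.* coeff (b · p) i     ≈⟨ coeff-· a (b · p) i ⟨
      coeff (a · (b · p)) i     ∎
      where open SetoidReasoning R.setoid

    1·-identity : ∀ p → (1# · p) ≋ p
    1·-identity p .at i = R.trans (coeff-· 1# p i) (R.*-identityˡ _)

    0·-zero : ∀ p → (0# · p) ≋ []
    0·-zero p .at i = R.trans (coeff-· 0# p i) (R.zeroˡ _)

    0∷[] : (0# ∷ []) ≋ []
    0∷[] .at zero    = R.refl
    0∷[] .at (suc i) = R.refl

  ⊕-isAbelianGroup : IsAbelianGroup _≋_ _⊕_ [] ⊖_
  ⊕-isAbelianGroup = record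
    { isGroup = record
      { isMonoid = record
        { isSemigroup = record
          { isMagma = record
            { isEquivalence = record { refl = ≋-refl ; sym = ≋-sym ; trans = ≋-trans }
            ; ∙-cong = ⊕-cong }
          ; assoc = ⊕-assoc }
        ; identity = (λ p → ≋-refl) , ⊕-identityʳ }
      ; inverse = ⊖-inverseˡ
                , λ p → ≋-trans (⊕-comm p (⊖ p)) (⊖-inverseˡ p)
      ; ⁻¹-cong = ⊖-cong }
    ; comm = ⊕-comm }

  ⊕-abelianGroup : AbelianGroup c ℓ
  ⊕-abelianGroup = record { isAbelianGroup = ⊕-isAbelianGroup }

  private
    open CommutativeSemigroupProperties (AbelianGroup.commutativeSemigroup ⊕-abelianGroup)
      using (x∙yz≈y∙xz; interchange)
    open SetoidReasoning (AbelianGroup.setoid ⊕-abelianGroup)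

    ⊛-congˡ : ∀ p {q q′} → q ≋ q′ → (p ⊛ q) ≋ (p ⊛ q′)
    ⊛-congˡ []      e = ≋-refl
    ⊛-congˡ (a ∷ p) e = ⊕-cong (·-cong R.refl e) (∷-cong R.refl (⊛-congˡ p e))

    ⊛-zeroʳ : ∀ p → (p ⊛ []) ≋ []
    ⊛-zeroʳ []      = ≋-refl
    ⊛-zeroʳ (a ∷ p) = ≋-trans (∷-cong R.refl (⊛-zeroʳ p)) 0∷[]

    ⊛-∷ : ∀ q a p → (q ⊛ (a ∷ p)) ≋ ((a · q) ⊕ (0# ∷ (q ⊛ p)))
    ⊛-∷ []      a p = ≋-sym 0∷[]
    ⊛-∷ (b ∷ q) a p = ∷-cong (R.+-congʳ (R.*-comm b a)) (begin
      (b · p) ⊕ (q ⊛ (a ∷ p))               ≈⟨ ⊕-cong ≋-refl (⊛-∷ q a p) ⟩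
      (b · p) ⊕ ((a · q) ⊕ (0# ∷ (q ⊛ p)))  ≈⟨ x∙yz≈y∙xz (b · p) (a · q) _ ⟩
      (a · q) ⊕ ((b · p) ⊕ (0# ∷ (q ⊛ p)))  ∎)

    ⊛-comm : ∀ p q → (p ⊛ q) ≋ (q ⊛ p)
    ⊛-comm []      q = ≋-sym (⊛-zeroʳ q)
    ⊛-comm (a ∷ p) q = begin
      (a · q) ⊕ (0# ∷ (p ⊛ q)) ≈⟨ ⊕-cong ≋-refl (∷-cong R.refl (⊛-comm p q)) ⟩
      (a · q) ⊕ (0# ∷ (q ⊛ p)) ≈⟨ ⊛-∷ q a p ⟨
      q ⊛ (a ∷ p)              ∎

    ⊛-cong : ∀ {p p′ q q′} → p ≋ p′ → q ≋ q′ → (p ⊛ q) ≋ (p′ ⊛ q′)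
    ⊛-cong {p} {p′} {q} {q′} e f = begin
      p ⊛ q    ≈⟨ ⊛-congˡ p f ⟩
      p ⊛ q′   ≈⟨ ⊛-comm p q′ ⟩
      q′ ⊛ p   ≈⟨ ⊛-congˡ q′ e ⟩
      q′ ⊛ p′  ≈⟨ ⊛-comm q′ p′ ⟩
      p′ ⊛ q′  ∎

    0∷-⊕ : ∀ p q → (0# ∷ (p ⊕ q)) ≋ ((0# ∷ p) ⊕ (0# ∷ q))
    0∷-⊕ p q = ∷-cong (R.sym (R.+-identityˡ 0#)) ≋-refl

    ⊛-distribˡ : ∀ p q r → (p ⊛ (q ⊕ r)) ≋ ((p ⊛ q) ⊕ (p ⊛ r))
    ⊛-distribˡ []      q r = ≋-refl
    ⊛-distribˡ (a ∷ p) q r = begin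
      (a · (q ⊕ r)) ⊕ (0# ∷ (p ⊛ (q ⊕ r)))
        ≈⟨ ⊕-cong (·-distrib-⊕ a q r) (∷-cong R.refl (⊛-distribˡ p q r)) ⟩
      ((a · q) ⊕ (a · r)) ⊕ (0# ∷ ((p ⊛ q) ⊕ (p ⊛ r)))
        ≈⟨ ⊕-cong ≋-refl (0∷-⊕ (p ⊛ q) (p ⊛ r)) ⟩
      ((a · q) ⊕ (a · r)) ⊕ ((0# ∷ (p ⊛ q)) ⊕ (0# ∷ (p ⊛ r)))
        ≈⟨ interchange (a · q) (a · r) (0# ∷ (p ⊛ q)) (0# ∷ (p ⊛ r)) ⟩
      ((a ∷ p) ⊛ q) ⊕ ((a ∷ p) ⊛ r) ∎

    ⊛-distribʳ : ∀ p q r → ((q ⊕ r) ⊛ p) ≋ ((q ⊛ p) ⊕ (r ⊛ p))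
    ⊛-distribʳ p q r = begin
      (q ⊕ r) ⊛ p        ≈⟨ ⊛-comm (q ⊕ r) p ⟩
      p ⊛ (q ⊕ r)        ≈⟨ ⊛-distribˡ p q r ⟩
      (p ⊛ q) ⊕ (p ⊛ r)  ≈⟨ ⊕-cong (⊛-comm p q) (⊛-comm p r) ⟩
      (q ⊛ p) ⊕ (r ⊛ p)  ∎

    ·-⊛ : ∀ a q r → ((a · q) ⊛ r) ≋ (a · (q ⊛ r))
    ·-⊛ a []      r = ≋-refl
    ·-⊛ a (b ∷ q) r = begin
      ((a R.* b) · r) ⊕ (0# ∷ ((a · q) ⊛ r))
        ≈⟨ ⊕-cong (·-·-assoc a b r) (∷-cong (R.sym (R.zeroʳ a)) (·-⊛ a q r)) ⟩
      (a · (b · r)) ⊕ (a · (0# ∷ (q ⊛ r)))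
        ≈⟨ ·-distrib-⊕ a (b · r) (0# ∷ (q ⊛ r)) ⟨
      a · ((b ∷ q) ⊛ r) ∎

    ⊛-assoc : ∀ p q r → ((p ⊛ q) ⊛ r) ≋ (p ⊛ (q ⊛ r))
    ⊛-assoc []      q r = ≋-refl
    ⊛-assoc (a ∷ p) q r = begin
      ((a · q) ⊕ (0# ∷ (p ⊛ q))) ⊛ r
        ≈⟨ ⊛-distribʳ r (a · q) (0# ∷ (p ⊛ q)) ⟩
      ((a · q) ⊛ r) ⊕ ((0# · r) ⊕ (0# ∷ ((p ⊛ q) ⊛ r)))
        ≈⟨ ⊕-cong (·-⊛ a q r) (⊕-cong (0·-zero r) (∷-cong R.refl (⊛-assoc p q r))) ⟩
      (a · (q ⊛ r)) ⊕ (0# ∷ (p ⊛ (q ⊛ r))) ∎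

    ⊛-identityˡ : ∀ p → (const 1# ⊛ p) ≋ p
    ⊛-identityˡ p = begin
      (1# · p) ⊕ (0# ∷ []) ≈⟨ ⊕-cong (1·-identity p) 0∷[] ⟩
      p ⊕ []               ≈⟨ ⊕-identityʳ p ⟩
      p                    ∎

  polynomialRing : CommutativeRing c ℓ
  polynomialRing = record
    { Carrier = Poly
    ; _≈_ = _≋_
    ; _+_ = _⊕_
    ; _*_ = _⊛_
    ; -_ = ⊖_
    ; 0# = []
    ; 1# = const 1#
    ; isCommutativeRing = record
      { isRing = record
        { +-isAbelianGroup = ⊕-isAbelianGroup
        ; *-cong = ⊛-cong
        ; *-assoc = ⊛-assoc
        ; *-identity = ⊛-identityˡ
                     , λ p → ≋-trans (⊛-comm p (const 1#)) (⊛-identityˡ p)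
        ; distrib = ⊛-distribˡ , ⊛-distribʳ }
      ; *-comm = ⊛-comm }
    }

-- Path n k: partial Motzkin paths from (0,0) to (n,k); heights are natural
-- numbers, so no path goes below the X-axis.  The last step is outermost.
data Path : ℕ → ℕ → Set where
  start : Path 0 0
  U : ∀ {n k} → Path n k       → Path (suc n) (suc k)
  D : ∀ {n k} → Path n (suc k) → Path (suc n) k
  H : ∀ {n k} → Path n k       → Path (suc n) k

paths : ∀ n k → List (Path n k)
paths zero    zero    = start ∷ []
paths zero    (suc k) = []
paths (suc n) zero    = map H (paths n zero) ++ map D (paths n 1)
paths (suc n) (suc k) =
  map U (paths n k) ++ map H (paths n (suc k)) ++ map D (paths n (suc (suc k)))

-- Every path is listed exactly once.
paths-complete : ∀ {n k} (p : Path n k) → p ∈ paths n k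
paths-complete start             = here refl
paths-complete (U p)             = ∈-++⁺ˡ (∈-map⁺ U (paths-complete p))
paths-complete {k = zero} (D p)  = ∈-++⁺ʳ (map H (paths _ _)) (∈-map⁺ D (paths-complete p))
paths-complete {k = suc k} (D p) =
  ∈-++⁺ʳ (map U (paths _ _)) (∈-++⁺ʳ (map H (paths _ _)) (∈-map⁺ D (paths-complete p)))
paths-complete {k = zero} (H p)  = ∈-++⁺ˡ (∈-map⁺ H (paths-complete p))
paths-complete {k = suc k} (H p) =
  ∈-++⁺ʳ (map U (paths _ _)) (∈-++⁺ˡ (∈-map⁺ H (paths-complete p)))

paths-unique : ∀ n k → Unique (paths n k)
paths-unique zero    zero    = [] ∷ []
paths-unique zero    (suc k) = []
paths-unique (suc n) k       = go k
  where
  U-injective : ∀ {k} {p q : Path n k} → U p ≡ U q → p ≡ q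
  U-injective refl = refl

  D-injective : ∀ {k} {p q : Path n (suc k)} → _≡_ {A = Path (suc n) k} (D p) (D q) → p ≡ q
  D-injective refl = refl

  H-injective : ∀ {k} {p q : Path n k} → _≡_ {A = Path (suc n) k} (H p) (H q) → p ≡ q
  H-injective refl = refl

  H#D : ∀ {k} (ps : List (Path n k)) (qs : List (Path n (suc k))) →
        Disjoint (map H ps) (map D qs)
  H#D ps qs (p∈ , q∈) with ∈-map⁻ H p∈ | ∈-map⁻ D q∈
  ... | _ , _ , refl | _ , _ , ()

  U#HD : ∀ {k} (ps : List (Path n k)) (qs : List (Path n (suc k)))
         (rs : List (Path n (suc (suc k)))) →
         Disjoint (map U ps) (map H qs ++ map D rs)
  U#HD ps qs rs (p∈ , q∈) with ∈-map⁻ U p∈ | ∈-++⁻ (map H qs) q∈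
  ... | _ , _ , refl | inj₁ h∈ with ∈-map⁻ H h∈
  ...   | _ , _ , ()
  U#HD ps qs rs (p∈ , q∈) | _ , _ , refl | inj₂ d∈ with ∈-map⁻ D d∈
  ...   | _ , _ , ()

  HD-unique : ∀ k → Unique (map H (paths n k) ++ map D (paths n (suc k)))
  HD-unique k = Unique.++⁺ (Unique.map⁺ H-injective (paths-unique n k))
                           (Unique.map⁺ D-injective (paths-unique n (suc k)))
                           (H#D (paths n k) (paths n (suc k)))

  go : ∀ k → Unique (paths (suc n) k)
  go zero    = HD-unique zero
  go (suc k) = Unique.++⁺ (Unique.map⁺ U-injective (paths-unique n k)) (HD-unique (suc k))
                          (U#HD (paths n k) (paths n (suc k)) (paths n (suc (suc k))))

module Weighted {c ℓ} (R : CommutativeRing c ℓ) where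
  open CommutativeRing R

  -- The height of a horizontal step is the final height of the path it ends.
  weight : Carrier → Carrier → ∀ {n k} → Path n k → Carrier
  weight x y start            = 1#
  weight x y (U p)            = weight x y p * 1#
  weight x y (D p)            = weight x y p * 1#
  weight x y (H {k = zero} p) = weight x y p * x
  weight x y (H {k = suc _} p) = weight x y p * y

  totalWeight : Carrier → Carrier → ℕ → ℕ → Carrier
  totalWeight x y n k = foldr _+_ 0# (map (weight x y) (paths n k))

-- ℤ[x,y] is built as (ℤ[y])[x].
module ℤ[y]   = Polynomial ℤₚ.+-*-commutativeRing
module ℤ[y,x] = Polynomial ℤ[y].polynomialRing

ℤ[x,y] : CommutativeRing 0ℓ 0ℓ
ℤ[x,y] = ℤ[y,x].polynomialRing

open CommutativeRing ℤ[x,y] public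
  using () renaming (Carrier to ℤ⟦x,y⟧; _≈_ to _≈ₚ_; _*_ to _*ₚ_; _-_ to _-ₚ_)
open MonoidSum (CommutativeRing.+-monoid ℤ[x,y]) public using (sum⁺-syntax)

𝕩 𝕪 : ℤ⟦x,y⟧
𝕩 = ℤ[y,x].indeterminate
𝕪 = ℤ[y,x].const ℤ[y].indeterminate

infix 9 _[x≔y]

_[x≔y] : ℤ⟦x,y⟧ → ℤ⟦x,y⟧
p [x≔y] = ℤ[y,x].const (ℤ[y,x].eval p ℤ[y].indeterminate)

M : ℕ → ℕ → ℤ⟦x,y⟧
M = Weighted.totalWeight ℤ[x,y] 𝕩 𝕪

det₂ : (a b c d : ℤ⟦x,y⟧) → ℤ⟦x,y⟧
det₂ a b c d = a *ₚ d -ₚ b *ₚ c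

{-# OPTIONS --safe #-}

-- Write a_k = M_{n,k} and b_j = M_{m,j}.  For k ≥ 1 the recurrence turns the
-- k-th determinant into E_k − E_{k−1} with E_k = a_k b_{k+ℓ+2} − a_{k+1} b_{k+ℓ+1},
-- so the sum telescopes.  Its last term E_{N₀} vanishes, as N₀ > n or N₀ + ℓ ≥ m,
-- and the k = 0 determinant leaves a_0 (b_ℓ + (y − x) b_{ℓ+1}).  The second
-- factor satisfies the recurrence of M_{m,ℓ}(y,y), hence equals it.
module Submission where

open import Defs
open import Algebra.Bundles using (AbelianGroup; CommutativeRing; Monoid)
import Algebra.Properties.AbelianGroup as AbelianGroupProperties
import Algebra.Properties.CommutativeSemigroup as CommutativeSemigroupProperties
import Algebra.Properties.Monoid.Sum as MonoidSum
import Algebra.Solver.Ring.NaturalCoefficients.Default as SemiringSolver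
open import Data.Fin.Base using (toℕ)
open import Data.List.Base using (List; []; _∷_; _++_; map; foldr)
open import Data.Nat.Base using (ℕ; zero; suc; _+_; _∸_; _⊓_; _≤_; _<_; s≤s)
import Data.Nat.Properties as ℕₚ
open import Data.Sum.Base using (inj₁; inj₂)
open import Function.Base using (_∘_)
open import Relation.Binary.PropositionalEquality using (_≡_) renaming (refl to ≡-refl)
import Relation.Binary.Reasoning.Setoid as SetoidReasoning

-- Telescoping sums and differences

module Telescoping {c ℓ} (S : Monoid c ℓ) where
  open Monoid S
  open MonoidSum S using (sum-syntax)
  open SetoidReasoning setoid

  -- The step is stated as an addition, so that a monoid suffices. The sum peels off its first term,
  -- hence the induction shifts both `F` and `d` by one.
  sum-telescope : (F d : ℕ → Carrier) → (∀ k → F k ∙ d k ≈ F (suc k)) →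
                  ∀ N → F 0 ∙ ∑[ k < N ] d (toℕ k) ≈ F N
  sum-telescope F d step zero    = identityʳ (F 0)
  sum-telescope F d step (suc N) = begin
    F 0 ∙ (d 0 ∙ ∑[ k < N ] d (suc (toℕ k))) ≈⟨ assoc _ _ _ ⟨
    F 0 ∙ d 0 ∙ ∑[ k < N ] d (suc (toℕ k))   ≈⟨ ∙-congʳ (step 0) ⟩
    F 1 ∙ ∑[ k < N ] d (suc (toℕ k))         ≈⟨ sum-telescope (F ∘ suc) (d ∘ suc) (step ∘ suc) N ⟩
    F (suc N)                                ∎

module Differences {c ℓ} (G : AbelianGroup c ℓ) where
  open AbelianGroup G renaming (_∙_ to _+ᴳ_; ∙-cong to +-cong; ∙-congˡ to +-congˡ; ∙-congʳ to +-congʳ)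
  open AbelianGroupProperties G using (⁻¹-∙-comm; //-rightDividesʳ)
  open CommutativeSemigroupProperties commutativeSemigroup using (interchange; xy∙z≈xz∙y)
  open SetoidReasoning setoid

  -- Moves an identity between differences into the range of the semiring solver.
  -‿cross : ∀ {p q r s} → p +ᴳ s ≈ r +ᴳ q → p - q ≈ r - s
  -‿cross {p} {q} {r} {s} e = begin
    p - q               ≈⟨ +-congʳ (//-rightDividesʳ s p) ⟨
    p +ᴳ s - s - q      ≈⟨ xy∙z≈xz∙y _ _ _ ⟩
    p +ᴳ s - q - s      ≈⟨ +-congʳ (+-congʳ e) ⟩
    r +ᴳ q - q - s      ≈⟨ +-congʳ (//-rightDividesʳ q r) ⟩
    r - s               ∎

  -‿+-interchange : ∀ p q r s → (p - q) +ᴳ (r - s) ≈ (p +ᴳ r) - (q +ᴳ s)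
  -‿+-interchange p q r s = begin
    (p - q) +ᴳ (r - s)            ≈⟨ interchange _ _ _ _ ⟩
    (p +ᴳ r) +ᴳ (q ⁻¹ +ᴳ s ⁻¹)    ≈⟨ +-congˡ (⁻¹-∙-comm q s) ⟩
    (p +ᴳ r) - (q +ᴳ s)           ∎

-- Vanishing and recurrence of the weighted path sums

paths-empty : ∀ {n k} → n < k → paths n k ≡ []
paths-empty {zero}  {suc k} _         = ≡-refl
-- Undoing the last step leads to height `k`, `suc k` or `suc (suc k)`, each above `n`.
paths-empty {suc n} {suc k} (s≤s n<k)
  rewrite paths-empty n<k
        | paths-empty (ℕₚ.m≤n⇒m≤1+n n<k)
        | paths-empty (ℕₚ.m≤n⇒m≤1+n (ℕₚ.m≤n⇒m≤1+n n<k)) = ≡-refl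

module Motzkin {c ℓ} (R : CommutativeRing c ℓ) where
  open CommutativeRing R renaming (_+_ to _+ᴿ_)
  open Weighted R
  open Differences +-abelianGroup
  open AbelianGroupProperties +-abelianGroup using (//-rightDividesˡ)
  open CommutativeSemigroupProperties +-commutativeSemigroup using (xy∙z≈xz∙y)
  open SemiringSolver commutativeSemiring using (solve; _:=_; _:+_; _:*_)
  open MonoidSum +-monoid using (sum-syntax)
  open Telescoping +-monoid
  open SetoidReasoning setoid

  private
    Σ[_] : ∀ {a} {A : Set a} → (A → Carrier) → List A → Carrier
    Σ[ f ] as = foldr _+ᴿ_ 0# (map f as)

    Σ-++ : ∀ {a} {A : Set a} (f : A → Carrier) as bs →
           Σ[ f ] (as ++ bs) ≈ Σ[ f ] as +ᴿ Σ[ f ] bs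
    Σ-++ f []       bs = sym (+-identityˡ _)
    Σ-++ f (a ∷ as) bs = trans (+-congˡ (Σ-++ f as bs)) (sym (+-assoc _ _ _))

    -- Here `s` appends one step of weight `r`; distributivity pulls the common factor `r` out of
    -- the whole sum.
    Σ-map-* : ∀ {a b} {A : Set a} {B : Set b} {f : A → Carrier} {g : B → Carrier}
              {s : A → B} {r} → (∀ p → g (s p) ≈ f p * r) →
              ∀ as → Σ[ g ] (map s as) ≈ Σ[ f ] as * r
    Σ-map-* e []       = sym (zeroˡ _)
    Σ-map-* e (a ∷ as) = trans (+-cong (e a) (Σ-map-* e as)) (sym (distribʳ _ _ _))

  module Recurrence (x y : Carrier) where
    private
      T : ℕ → ℕ → Carrier
      T = totalWeight x y

      Σ-map-1 : ∀ {n k n′ k′} {s : Path n k → Path n′ k′} →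
                (∀ p → weight x y (s p) ≈ weight x y p * 1#) →
                ∀ ps → Σ[ weight x y ] (map s ps) ≈ Σ[ weight x y ] ps
      Σ-map-1 e ps = trans (Σ-map-* e ps) (*-identityʳ _)

    -- Splits by the last step, following the concatenation in `paths`. No up step ends at height 0,
    -- and the horizontal step lies on the axis.
    totalWeight-suc-zero : ∀ n → T (suc n) 0 ≈ T n 0 * x +ᴿ T n 1
    totalWeight-suc-zero n = begin
      T (suc n) 0
        ≈⟨ Σ-++ (weight x y) (map H (paths n 0)) _ ⟩
      Σ[ weight x y ] (map H (paths n 0)) +ᴿ Σ[ weight x y ] (map D (paths n 1))
        ≈⟨ +-cong (Σ-map-* (λ _ → refl) (paths n 0)) (Σ-map-1 (λ _ → refl) (paths n 1)) ⟩
      T n 0 * x +ᴿ T n 1 ∎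

    totalWeight-suc-suc : ∀ n k →
      T (suc n) (suc k) ≈ T n k +ᴿ (T n (suc k) * y +ᴿ T n (suc (suc k)))
    totalWeight-suc-suc n k = begin
      T (suc n) (suc k)
        ≈⟨ Σ-++ (weight x y) (map U (paths n k)) _ ⟩
      _ +ᴿ Σ[ weight x y ] (map H (paths n (suc k)) ++ map D (paths n (suc (suc k))))
        ≈⟨ +-congˡ (Σ-++ (weight x y) (map H (paths n (suc k))) _) ⟩
      Σ[ weight x y ] (map U (paths n k)) +ᴿ
      (Σ[ weight x y ] (map H (paths n (suc k))) +ᴿ Σ[ weight x y ] (map D (paths n (suc (suc k)))))
        ≈⟨ +-cong (Σ-map-1 (λ _ → refl) (paths n k))
             (+-cong (Σ-map-* (λ _ → refl) (paths n (suc k)))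
                     (Σ-map-1 (λ _ → refl) (paths n (suc (suc k))))) ⟩
      T n k +ᴿ (T n (suc k) * y +ᴿ T n (suc (suc k))) ∎

    totalWeight-vanishes : ∀ {n k} → n < k → T n k ≈ 0#
    totalWeight-vanishes n<k rewrite paths-empty n<k = refl

  -- Comparison of the weights (y,y) and (x,y)

  module _ (x y : Carrier) where
    open Recurrence x y

    private
      T : ℕ → ℕ → Carrier
      T = totalWeight x y

      z : Carrier
      z = y - x

      -- Replacing `y` by `z +ᴿ x` hides the subtraction inside the variable `z`, so that the
      -- semiring solver applies.
      z+x≈y : z +ᴿ x ≈ y
      z+x≈y = //-rightDividesˡ x y

      det : (a b c d : Carrier) → Carrier
      det a b c d = a * d - b * c

    -- M(y,y) and M(x,y) differ only in the weight at height 0, so it is enough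
    -- to check that the right-hand side satisfies the recurrence of M(y,y).
    totalWeight-diagonal : ∀ m l →
      totalWeight y y m l ≈ T m l +ᴿ (y - x) * T m (suc l)
    totalWeight-diagonal zero zero    = sym (trans (+-congˡ (zeroʳ _)) (+-identityʳ _))
    totalWeight-diagonal zero (suc l) = sym (trans (+-congˡ (zeroʳ _)) (+-identityʳ _))
    totalWeight-diagonal (suc m) zero = begin
      totalWeight y y (suc m) 0
        ≈⟨ Recurrence.totalWeight-suc-zero y y m ⟩
      totalWeight y y m 0 * y +ᴿ totalWeight y y m 1
        ≈⟨ +-cong (*-cong (totalWeight-diagonal m 0) (sym z+x≈y)) (totalWeight-diagonal m 1) ⟩
      (b₀ +ᴿ z * b₁) * (z +ᴿ x) +ᴿ (b₁ +ᴿ z * b₂)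
        ≈⟨ solve 5 (λ x z b₀ b₁ b₂ →
             (b₀ :+ z :* b₁) :* (z :+ x) :+ (b₁ :+ z :* b₂) :=
             (b₀ :* x :+ b₁) :+ z :* (b₀ :+ (b₁ :* (z :+ x) :+ b₂)))
             refl x z b₀ b₁ b₂ ⟩
      (b₀ * x +ᴿ b₁) +ᴿ z * (b₀ +ᴿ (b₁ * (z +ᴿ x) +ᴿ b₂))
        ≈⟨ +-cong (totalWeight-suc-zero m)
             (*-congˡ (trans (totalWeight-suc-suc m 0)
                             (+-congˡ (+-congʳ (*-congˡ (sym z+x≈y)))))) ⟨
      T (suc m) 0 +ᴿ z * T (suc m) 1 ∎
      where b₀ = T m 0 ; b₁ = T m 1 ; b₂ = T m 2
    totalWeight-diagonal (suc m) (suc l) = begin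
      totalWeight y y (suc m) (suc l)
        ≈⟨ Recurrence.totalWeight-suc-suc y y m l ⟩
      totalWeight y y m l +ᴿ (totalWeight y y m (1 + l) * y +ᴿ totalWeight y y m (2 + l))
        ≈⟨ +-cong (totalWeight-diagonal m l)
             (+-cong (*-congʳ (totalWeight-diagonal m (1 + l))) (totalWeight-diagonal m (2 + l))) ⟩
      (b₀ +ᴿ z * b₁) +ᴿ ((b₁ +ᴿ z * b₂) * y +ᴿ (b₂ +ᴿ z * b₃))
        ≈⟨ solve 6 (λ y z b₀ b₁ b₂ b₃ →
             (b₀ :+ z :* b₁) :+ ((b₁ :+ z :* b₂) :* y :+ (b₂ :+ z :* b₃)) :=
             (b₀ :+ (b₁ :* y :+ b₂)) :+ z :* (b₁ :+ (b₂ :* y :+ b₃)))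
             refl y z b₀ b₁ b₂ b₃ ⟩
      (b₀ +ᴿ (b₁ * y +ᴿ b₂)) +ᴿ z * (b₁ +ᴿ (b₂ * y +ᴿ b₃))
        ≈⟨ +-cong (totalWeight-suc-suc m l) (*-congˡ (totalWeight-suc-suc m (1 + l))) ⟨
      T (suc m) (suc l) +ᴿ z * T (suc m) (2 + l) ∎
      where b₀ = T m l ; b₁ = T m (1 + l) ; b₂ = T m (2 + l) ; b₃ = T m (3 + l)

    -- Telescoping of the determinants

    module _ (n m l : ℕ) where
      private
        a b : ℕ → Carrier
        a k = T n k
        b k = T m (k + l)

        -- `E k` arises from `Δ k` by replacing the second row with the first row shifted one
        -- column. The partial sum of `Δ 0` to `Δ k` is `E k +ᴿ C`.
        Δ E : ℕ → Carrier
        Δ k = det (a k) (b (1 + k)) (T (suc n) k) (T (suc m) (1 + k + l))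
        E k = det (a k) (b (1 + k)) (a (1 + k)) (b (2 + k))

        -- The right-hand side of the theorem, with its second factor rewritten by
        -- `totalWeight-diagonal`.
        C : Carrier
        C = a 0 * (b 0 +ᴿ z * b 1)

        -- The column of `a` sits on the axis and has weight `x`, while that of `b` sits above it
        -- with weight `y`. The mismatch leaves `z * (a 0 * b 1)`, and the up step into height
        -- `1 + l` contributes `a 0 * b 0`; together these are `C`.
        Δ-zero : Δ 0 ≈ E 0 +ᴿ C
        Δ-zero = begin
          Δ 0
            ≈⟨ +-cong (*-congˡ (trans (totalWeight-suc-suc m l)
                                      (+-congˡ (+-congʳ (*-congˡ (sym z+x≈y))))))
                      (-‿cong (*-congˡ (totalWeight-suc-zero n))) ⟩
          a₀ * (b₀ +ᴿ (b₁ * (z +ᴿ x) +ᴿ b₂)) - b₁ * (a₀ * x +ᴿ a₁)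
            ≈⟨ -‿cross (solve 7 (λ x z a₀ a₁ b₀ b₁ b₂ →
                 a₀ :* (b₀ :+ (b₁ :* (z :+ x) :+ b₂)) :+ b₁ :* a₁ :=
                 (a₀ :* b₂ :+ a₀ :* (b₀ :+ z :* b₁)) :+ b₁ :* (a₀ :* x :+ a₁))
                 refl x z a₀ a₁ b₀ b₁ b₂) ⟩
          (a₀ * b₂ +ᴿ C) - b₁ * a₁
            ≈⟨ xy∙z≈xz∙y _ _ _ ⟩
          E 0 +ᴿ C ∎
          where a₀ = a 0 ; a₁ = a 1 ; b₀ = b 0 ; b₁ = b 1 ; b₂ = b 2

        -- Both heights are now positive, so the two horizontal terms carry the same weight `y` and
        -- cancel. The up-step terms cancel `E k`, and the down-step terms form `E (suc k)`.
        E-suc : ∀ k → E k +ᴿ Δ (suc k) ≈ E (suc k)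
        E-suc k = begin
          E k +ᴿ Δ (suc k)
            ≈⟨ +-congˡ (+-cong (*-congˡ (totalWeight-suc-suc m (1 + k + l)))
                               (-‿cong (*-congˡ (totalWeight-suc-suc n k)))) ⟩
          (a₀ * b₂ - b₁ * a₁) +ᴿ
          (a₁ * (b₁ +ᴿ (b₂ * y +ᴿ b₃)) - b₂ * (a₀ +ᴿ (a₁ * y +ᴿ a₂)))
            ≈⟨ -‿+-interchange _ _ _ _ ⟩
          (a₀ * b₂ +ᴿ a₁ * (b₁ +ᴿ (b₂ * y +ᴿ b₃))) -
          (b₁ * a₁ +ᴿ b₂ * (a₀ +ᴿ (a₁ * y +ᴿ a₂)))
            ≈⟨ -‿cross (solve 7 (λ y a₀ a₁ a₂ b₁ b₂ b₃ →
                 (a₀ :* b₂ :+ a₁ :* (b₁ :+ (b₂ :* y :+ b₃))) :+ b₂ :* a₂ :=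
                 a₁ :* b₃ :+ (b₁ :* a₁ :+ b₂ :* (a₀ :+ (a₁ :* y :+ a₂))))
                 refl y a₀ a₁ a₂ b₁ b₂ b₃) ⟩
          E (suc k) ∎
          where a₀ = a k ; a₁ = a (1 + k) ; a₂ = a (2 + k)
                b₁ = b (1 + k) ; b₂ = b (2 + k) ; b₃ = b (3 + k)

        det-zero : ∀ {p q r s} → p * s ≈ 0# → q * r ≈ 0# → det p q r s ≈ 0#
        det-zero e f = trans (+-cong e (-‿cong f)) (-‿inverseʳ 0#)

        a-vanishes : ∀ {k} → n < k → a k ≈ 0#
        a-vanishes = totalWeight-vanishes

        -- The height `k + l` exceeds `m`, because `m` is at most `l + (m ∸ l)`.
        b-vanishes : ∀ {k} → m ∸ l < k → b k ≈ 0#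
        b-vanishes m∸l<k = totalWeight-vanishes
          (ℕₚ.≤-<-trans (ℕₚ.≤-trans (ℕₚ.m≤n+m∸n m l) (ℕₚ.≤-reflexive (ℕₚ.+-comm l (m ∸ l))))
                        (ℕₚ.+-monoˡ-< l m∸l<k))

        -- Each product in `E N` has one factor from `a`, at index `N` or `N + 1`, and one from `b`,
        -- at index `N + 1` or `N + 2`. If `N` is `suc n`, both factors from `a` vanish; if `N` is
        -- `m ∸ l`, both factors from `b` do.
        E-last : E (suc n ⊓ (m ∸ l)) ≈ 0#
        E-last with ℕₚ.⊓-sel (suc n) (m ∸ l)
        ... | inj₁ e rewrite e = det-zero
          (trans (*-congʳ (a-vanishes (ℕₚ.n<1+n n))) (zeroˡ _))
          (trans (*-congˡ (a-vanishes (ℕₚ.m<n⇒m<1+n (ℕₚ.n<1+n n)))) (zeroʳ _))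
        ... | inj₂ e rewrite e = det-zero
          (trans (*-congˡ (b-vanishes (ℕₚ.m<n⇒m<1+n (ℕₚ.n<1+n (m ∸ l))))) (zeroʳ _))
          (trans (*-congʳ (b-vanishes (ℕₚ.n<1+n (m ∸ l)))) (zeroˡ _))

      sum-det : ∑[ k < suc (suc n ⊓ (m ∸ l)) ]
                  (T n (toℕ k) * T (suc m) (suc (toℕ k + l))
                   - T m (suc (toℕ k + l)) * T (suc n) (toℕ k))
                ≈ T n 0 * totalWeight y y m l
      sum-det = begin
        -- The sum has `suc N` terms and unfolds definitionally into its term at 0 and the `N`
        -- others.
        Δ 0 +ᴿ ∑[ k < N ] Δ (suc (toℕ k))
          ≈⟨ +-congʳ Δ-zero ⟩
        E 0 +ᴿ C +ᴿ ∑[ k < N ] Δ (suc (toℕ k))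
          -- `C` is carried along in every partial sum, which makes `E 0 +ᴿ C` the starting value.
          ≈⟨ sum-telescope (λ k → E k +ᴿ C) (Δ ∘ suc)
               (λ k → trans (xy∙z≈xz∙y _ _ _) (+-congʳ (E-suc k))) N ⟩
        E N +ᴿ C
          ≈⟨ trans (+-congʳ E-last) (+-identityˡ C) ⟩
        C
          ≈⟨ *-congˡ (totalWeight-diagonal m l) ⟨
        T n 0 * totalWeight y y m l ∎
        where N = suc n ⊓ (m ∸ l)

-- Path sums under ring homomorphisms

module WeightHomomorphism {c₁ ℓ₁ c₂ ℓ₂} (A : CommutativeRing c₁ ℓ₁) (B : CommutativeRing c₂ ℓ₂) where
  private
    module A = CommutativeRing A
    module B = CommutativeRing B
    module WA = Weighted A
    module WB = Weighted B
  open B using (_≈_)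

  -- φ need not respect the equality of A, since paths are mapped one by one.
  module _ (φ : A.Carrier → B.Carrier)
           (φ-+ : ∀ p q → φ (p A.+ q) ≈ φ p B.+ φ q)
           (φ-* : ∀ p q → φ (p A.* q) ≈ φ p B.* φ q)
           (φ-0 : φ A.0# ≈ B.0#) (φ-1 : φ A.1# ≈ B.1#)
           {x y x′ y′} (φ-x : φ x ≈ x′) (φ-y : φ y ≈ y′) where

    weight-homo : ∀ {n k} (p : Path n k) → φ (WA.weight x y p) ≈ WB.weight x′ y′ p
    weight-homo start             = φ-1
    weight-homo (U p)             = B.trans (φ-* _ _) (B.*-cong (weight-homo p) φ-1)
    weight-homo (D p)             = B.trans (φ-* _ _) (B.*-cong (weight-homo p) φ-1)
    weight-homo (H {k = zero} p)  = B.trans (φ-* _ _) (B.*-cong (weight-homo p) φ-x)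
    weight-homo (H {k = suc _} p) = B.trans (φ-* _ _) (B.*-cong (weight-homo p) φ-y)

    totalWeight-homo : ∀ n k → φ (WA.totalWeight x y n k) ≈ WB.totalWeight x′ y′ n k
    totalWeight-homo n k = go (paths n k)
      where
      go : ∀ ps → φ (foldr A._+_ A.0# (map (WA.weight x y) ps)) ≈
                  foldr B._+_ B.0# (map (WB.weight x′ y′) ps)
      go []       = φ-0
      go (p ∷ ps) = B.trans (φ-+ _ _) (B.+-cong (weight-homo p) (go ps))

-- Evaluation and constant polynomials as homomorphisms

module Evaluation {c ℓ} (R : CommutativeRing c ℓ) where
  open CommutativeRing R renaming (_+_ to _+ᴿ_)
  open Polynomial R
  open SemiringSolver commutativeSemiring using (solve; _:=_; _:+_; _:*_)
  open SetoidReasoning setoid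

  module _ (r : Carrier) where
    eval-⊕ : ∀ p q → eval (p ⊕ q) r ≈ eval p r +ᴿ eval q r
    eval-⊕ []      q       = sym (+-identityˡ _)
    eval-⊕ (a ∷ p) []      = sym (+-identityʳ _)
    eval-⊕ (a ∷ p) (b ∷ q) = begin
      a +ᴿ b +ᴿ r * eval (p ⊕ q) r               ≈⟨ +-congˡ (*-congˡ (eval-⊕ p q)) ⟩
      a +ᴿ b +ᴿ r * (eval p r +ᴿ eval q r)
        ≈⟨ solve 5 (λ a b r p q → a :+ b :+ r :* (p :+ q) := (a :+ r :* p) :+ (b :+ r :* q))
             refl a b r (eval p r) (eval q r) ⟩
      eval (a ∷ p) r +ᴿ eval (b ∷ q) r           ∎

    eval-· : ∀ a p → eval (a · p) r ≈ a * eval p r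
    eval-· a []      = sym (zeroʳ a)
    eval-· a (b ∷ p) = begin
      a * b +ᴿ r * eval (a · p) r     ≈⟨ +-congˡ (*-congˡ (eval-· a p)) ⟩
      a * b +ᴿ r * (a * eval p r)
        ≈⟨ solve 4 (λ a b r p → a :* b :+ r :* (a :* p) := a :* (b :+ r :* p))
             refl a b r (eval p r) ⟩
      a * eval (b ∷ p) r              ∎

    eval-⊛ : ∀ p q → eval (p ⊛ q) r ≈ eval p r * eval q r
    eval-⊛ []      q = sym (zeroˡ _)
    eval-⊛ (a ∷ p) q = begin
      eval ((a · q) ⊕ (0# ∷ (p ⊛ q))) r
        ≈⟨ eval-⊕ (a · q) (0# ∷ (p ⊛ q)) ⟩
      eval (a · q) r +ᴿ (0# +ᴿ r * eval (p ⊛ q) r)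
        ≈⟨ +-cong (eval-· a q) (trans (+-identityˡ _) (*-congˡ (eval-⊛ p q))) ⟩
      a * eval q r +ᴿ r * (eval p r * eval q r)
        ≈⟨ solve 4 (λ a r p q → a :* q :+ r :* (p :* q) := (a :+ r :* p) :* q)
             refl a r (eval p r) (eval q r) ⟩
      eval (a ∷ p) r * eval q r ∎

    eval-const : ∀ a → eval (const a) r ≈ a
    eval-const a = trans (+-congˡ (zeroʳ r)) (+-identityʳ a)

    eval-indeterminate : eval indeterminate r ≈ r
    eval-indeterminate = begin
      0# +ᴿ r * eval (const 1#) r  ≈⟨ +-identityˡ _ ⟩
      r * eval (const 1#) r        ≈⟨ *-congˡ (eval-const 1#) ⟩
      r * 1#                       ≈⟨ *-identityʳ r ⟩
      r                            ∎

  const-cong : ∀ {a b} → a ≈ b → const a ≋ const b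
  const-cong e .at zero    = e
  const-cong e .at (suc i) = refl

  const-⊛ : ∀ a b → const (a * b) ≋ (const a ⊛ const b)
  const-⊛ a b .at zero    = sym (+-identityʳ _)
  const-⊛ a b .at (suc i) = refl

  -- The zero polynomial is the empty list, so the two sides differ by a trailing zero.
  const-0 : const 0# ≋ []
  const-0 .at zero    = refl
  const-0 .at (suc i) = refl

-- The substitution x = y and the theorem over the integers

-- Substitution is evaluation at `Y` followed by `const`. It preserves sums, products, 0 and 1 and
-- sends both `𝕩` and `𝕪` to `𝕪`, so it turns each (x,y)-weight into the (y,y)-weight of the same
-- path.
M[x≔y] : ∀ m l → (M m l) [x≔y] ≈ₚ Weighted.totalWeight ℤ[x,y] 𝕪 𝕪 m l
M[x≔y] = totalWeight-homo _[x≔y]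
  (λ p q → const-cong (eval-⊕ Y p q))
  (λ p q → ≈-trans (const-cong (eval-⊛ Y p q)) (const-⊛ (ℤ[y,x].eval p Y) (ℤ[y,x].eval q Y)))
  const-0
  (const-cong (eval-const Y (CommutativeRing.1# ℤ[y].polynomialRing)))
  (const-cong (eval-indeterminate Y))
  (const-cong (eval-const Y Y))
  where
  open WeightHomomorphism ℤ[x,y] ℤ[x,y]
  open Evaluation ℤ[y].polynomialRing
  open CommutativeRing ℤ[x,y] using () renaming (trans to ≈-trans)
  Y = ℤ[y].indeterminate

theorem3p3 : (n m ℓ : ℕ) → ℓ ≤ m →
    ∑[ k ≤ suc n ⊓ (m ∸ ℓ) ]
    det₂ (M n       (toℕ k)) (M m       (suc (toℕ k + ℓ)))
    (M (suc n) (toℕ k)) (M (suc m) (suc (toℕ k + ℓ)))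
    ≈ₚ M n 0 *ₚ (M m ℓ) [x≔y]
theorem3p3 n m ℓ _ =
  ≈-trans (sum-det 𝕩 𝕪 n m ℓ) (*-congˡ {x = M n 0} (≈-sym (M[x≔y] m ℓ)))
  where
  open Motzkin ℤ[x,y]
  open CommutativeRing ℤ[x,y] using (*-congˡ) renaming (trans to ≈-trans; sym to ≈-sym)
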